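{- Let $p$ be a non-negative integer and let $G$ be a connected $\{\text{butterfly},\text{hammer},(K_1\cup K_2)+K_p\}$-free graph with $\omega(G)\geq 2p$. If $\omega(G)\neq 2$, then $G$ is perfect.
   Context: All graphs are simple, finite and undirected. $\omega(G)$ is the clique number and $\chi(G)$ the chromatic number of $G$. A graph $G$ is perfect if $\chi(H)=\omega(H)$ for every induced subgraph $H$ of $G$. For a family $\mathcal{F}$ of graphs, $G$ is $\mathcal{F}$-free if it has no induced subgraph isomorphic to a member of $\mathcal{F}$. The butterfly is the graph on five vertices consisting of two triangles sharing exactly one vertex (with no other edges). The hammer is the graph on five vertices $a,b,c,d,e$ with edges $ab,bc,ac,cd,de$. $K_n$ is the complete graph on $n$ vertices, $K_1\cup K_2$ is the disjoint union of $K_1$ and $K_2$, and for vertex-disjoint graphs $G_1,G_2$ the join $G_1+G_2$ is obtained from their disjoint union by adding all edges between $V(G_1)$ and $V(G_2)$; for $p=0$, $(K_1\cup K_2)+K_p$ is $K_1\cup K_2$. -}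

module Defs where

open import Data.Empty using (⊥-elim)
open import Data.Fin using (Fin; splitAt; finToFun; funToFin)
open import Data.Fin.Patterns using (0F; 1F; 2F; 3F; 4F)
open import Data.Fin.Properties using (_≟_; all?; any?; finToFun-funToFin)
open import Data.Fin.Subset using (Subset; _∈_; ∣_∣; ⊥)
open import Data.Fin.Subset.Properties using (_∈?_; anySubset?; ∉⊥; ∣p∣≤n; ∣⊥∣≡0)
open import Data.List using (List; []; _∷_)
open import Data.List.Relation.Unary.All using (All)
import Data.List.Membership.DecPropositional as DecMembership
open import Data.Nat using (ℕ; zero; suc; _+_; _≤_; z≤n; s≤s)
import Data.Nat.Properties as ℕ
open import Data.Product using (∃; _×_; _,_; proj₁; proj₂)
import Data.Product.Properties as Product
open import Data.Sum using (_⊎_; inj₁; inj₂; swap)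
open import Data.Sum.Relation.Binary.Pointwise
  using (Pointwise; inj₁; inj₂; ⊎-symmetric; ⊎-decidable)
open import Data.Unit using (⊤; tt)
open import Function using (_∘_)
open import Function.Bundles using (_⇔_)
open import Function.Definitions using (Injective)
open import Level using (0ℓ)
open import Relation.Binary using (Rel; Symmetric; Decidable)
open import Relation.Binary.Construct.Closure.ReflexiveTransitive using (Star)
open import Relation.Binary.PropositionalEquality
  using (_≡_; _≢_; refl; sym; trans)
open import Relation.Nullary using (¬_; yes; no; contradiction)
open import Relation.Nullary.Decidable using (map′; ¬?; _×-dec_; _⊎-dec_; _→-dec_)
open import Relation.Unary using (Pred) renaming (Decidable to Decidable₁)

-- The vertex set of a graph on n vertices is Fin n, with n = 0 allowed.
record Graph (n : ℕ) : Set₁ where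
  field
    Adj     : Rel (Fin n) 0ℓ
    adj?    : Decidable Adj
    symm    : Symmetric Adj
    irrefl  : ∀ {v} → ¬ Adj v v

open Graph public

private
  variable
    m n : ℕ

-- An embedding is an isomorphism of H onto the subgraph of G induced by the
-- range of `fun`.  As f ranges over all embeddings into G, the graphs H are
-- exactly the induced subgraphs of G, up to isomorphism.
record _↪_ (H : Graph m) (G : Graph n) : Set where
  field
    fun        : Fin m → Fin n
    injective  : Injective _≡_ _≡_ fun
    adj-iff    : ∀ u v → Adj H u v ⇔ Adj G (fun u) (fun v)

open _↪_ public

Free : List (∃ Graph) → Graph n → Set₁
Free F G = All (λ H → ¬ (proj₂ H ↪ G)) F

-- The empty graph counts as connected.
Connected : Graph n → Set
Connected G = ∀ u v → Star (Adj G) u v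

IsGreatest : Pred ℕ 0ℓ → ℕ → Set
IsGreatest P k = P k × (∀ j → P j → j ≤ k)

IsLeast : Pred ℕ 0ℓ → ℕ → Set
IsLeast P k = P k × (∀ j → P j → k ≤ j)

greatest : ∀ {P : Pred ℕ 0ℓ} → Decidable₁ P → P 0 →
           ∀ b → (∀ j → P j → j ≤ b) → ∃ (IsGreatest P)
greatest P? p₀ zero    bound = 0 , p₀ , bound
greatest P? p₀ (suc b) bound with P? (suc b)
... | yes p = suc b , p , bound
... | no ¬p = greatest P? p₀ b λ j pj →
  ℕ.≤-pred (ℕ.≤∧≢⇒< (bound j pj) λ { refl → ¬p pj })

least : ∀ {P : Pred ℕ 0ℓ} → Decidable₁ P → ∀ b → P b → ∃ (IsLeast P)
least P? zero    pb = 0 , pb , λ _ _ → z≤n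
least {P} P? (suc b) pb with P? 0
... | yes p₀ = 0 , p₀ , λ _ _ → z≤n
... | no ¬p₀ with least (P? ∘ suc) b pb
...   | k , pk , min = suc k , pk , λ
  { zero    p₀ → contradiction p₀ ¬p₀
  ; (suc j) pj → s≤s (min j pj)
  }

IsClique : Graph n → Subset n → Set
IsClique G S = ∀ u v → u ∈ S → v ∈ S → u ≢ v → Adj G u v

HasClique : Graph n → ℕ → Set
HasClique G k = ∃ λ S → IsClique G S × ∣ S ∣ ≡ k

hasClique? : (G : Graph n) → Decidable₁ (HasClique G)
hasClique? G k = anySubset? λ S →
  (all? λ u → all? λ v →
     (u ∈? S) →-dec ((v ∈? S) →-dec (¬? (u ≟ v) →-dec adj? G u v)))
  ×-dec (∣ S ∣ ℕ.≟ k)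

cliqueNumber : (G : Graph n) → ∃ (IsGreatest (HasClique G))
cliqueNumber {n} G = greatest (hasClique? G)
  (⊥ , (λ _ _ u∈⊥ → ⊥-elim (∉⊥ u∈⊥)) , ∣⊥∣≡0 n)
  n (λ { _ (S , _ , refl) → ∣p∣≤n S })

ω : Graph n → ℕ
ω G = proj₁ (cliqueNumber G)

IsProper : (G : Graph n) {k : ℕ} → (Fin n → Fin k) → Set
IsProper G c = ∀ u v → Adj G u v → c u ≢ c v

Colourable : Graph n → ℕ → Set
Colourable {n} G k = ∃ λ (c : Fin n → Fin k) → IsProper G c

colourable? : (G : Graph n) → Decidable₁ (Colourable G)
colourable? {n} G k =
  map′ (λ (i , proper) → finToFun i , proper)
       (λ (c , proper) → funToFin c , λ u v uv eq → proper u v uv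
          (trans (sym (finToFun-funToFin c u)) (trans eq (finToFun-funToFin c v))))
       (any? λ i → all? λ u → all? λ v →
          adj? G u v →-dec ¬? (finToFun {k} {n} i u ≟ finToFun {k} {n} i v))

chromaticNumber : (G : Graph n) → ∃ (IsLeast (Colourable G))
chromaticNumber {n} G = least (colourable? G) n
  ((λ v → v) , λ { _ _ uu refl → irrefl G uu })

χ : Graph n → ℕ
χ G = proj₁ (chromaticNumber G)

Perfect : Graph n → Set₁
Perfect G = ∀ {m} (H : Graph m) → H ↪ G → χ H ≡ ω H

-- Edges may be listed in either orientation; loops are discarded.
fromEdges : List (Fin n × Fin n) → Graph n
fromEdges {n} es = record
  { Adj    = λ u v → u ≢ v × ((u , v) ∈ₑ es ⊎ (v , u) ∈ₑ es)
  ; adj?   = λ u v → ¬? (u ≟ v) ×-dec (((u , v) ∈ₑ? es) ⊎-dec ((v , u) ∈ₑ? es))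
  ; symm   = λ (u≢v , e) → u≢v ∘ sym , swap e
  ; irrefl = λ (v≢v , _) → v≢v refl
  }
  where open DecMembership (Product.≡-dec (_≟_ {n}) (_≟_ {n})) renaming (_∈_ to _∈ₑ_; _∈?_ to _∈ₑ?_)

complete : ∀ n → Graph n
complete n = record
  { Adj    = _≢_
  ; adj?   = λ u v → ¬? (u ≟ v)
  ; symm   = λ u≢v → u≢v ∘ sym
  ; irrefl = λ v≢v → v≢v refl
  }

-- In G₁ ∪ᴳ G₂ and G₁ +ᴳ G₂ the first m vertices are those of G₁ and the
-- last n those of G₂.

infixr 6 _∪ᴳ_ _+ᴳ_

_∪ᴳ_ : Graph m → Graph n → Graph (m + n)
_∪ᴳ_ {m} G₁ G₂ = record
  { Adj    = λ u v → Pointwise (Adj G₁) (Adj G₂) (splitAt m u) (splitAt m v)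
  ; adj?   = λ u v → ⊎-decidable (adj? G₁) (adj? G₂) (splitAt m u) (splitAt m v)
  ; symm   = ⊎-symmetric (symm G₁) (symm G₂)
  ; irrefl = λ {v} → irr (splitAt m v)
  }
  where
  irr : ∀ x → ¬ Pointwise (Adj G₁) (Adj G₂) x x
  irr _ (inj₁ e) = irrefl G₁ e
  irr _ (inj₂ e) = irrefl G₂ e

JoinAdj : Graph m → Graph n → Rel (Fin m ⊎ Fin n) 0ℓ
JoinAdj G₁ G₂ (inj₁ u) (inj₁ v) = Adj G₁ u v
JoinAdj G₁ G₂ (inj₂ u) (inj₂ v) = Adj G₂ u v
JoinAdj G₁ G₂ (inj₁ _) (inj₂ _) = ⊤
JoinAdj G₁ G₂ (inj₂ _) (inj₁ _) = ⊤

_+ᴳ_ : Graph m → Graph n → Graph (m + n)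
_+ᴳ_ {m} {n} G₁ G₂ = record
  { Adj    = λ u v → JoinAdj G₁ G₂ (splitAt m u) (splitAt m v)
  ; adj?   = λ u v → dec (splitAt m u) (splitAt m v)
  ; symm   = λ {u} {v} → sy (splitAt m u) (splitAt m v)
  ; irrefl = λ {v} → irr (splitAt m v)
  }
  where
  dec : Decidable (JoinAdj G₁ G₂)
  dec (inj₁ u) (inj₁ v) = adj? G₁ u v
  dec (inj₂ u) (inj₂ v) = adj? G₂ u v
  dec (inj₁ _) (inj₂ _) = yes tt
  dec (inj₂ _) (inj₁ _) = yes tt

  sy : ∀ x y → JoinAdj G₁ G₂ x y → JoinAdj G₁ G₂ y x
  sy (inj₁ _) (inj₁ _) e = symm G₁ e
  sy (inj₂ _) (inj₂ _) e = symm G₂ e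
  sy (inj₁ _) (inj₂ _) _ = tt
  sy (inj₂ _) (inj₁ _) _ = tt

  irr : ∀ x → ¬ JoinAdj G₁ G₂ x x
  irr (inj₁ _) = irrefl G₁
  irr (inj₂ _) = irrefl G₂

butterfly : Graph 5
butterfly = fromEdges
  ((0F , 1F) ∷ (1F , 2F) ∷ (0F , 2F) ∷ (2F , 3F) ∷ (3F , 4F) ∷ (2F , 4F) ∷ [])

-- The vertices a, b, c, d, e are 0F, 1F, 2F, 3F, 4F.
hammer : Graph 5
hammer = fromEdges
  ((0F , 1F) ∷ (1F , 2F) ∷ (0F , 2F) ∷ (2F , 3F) ∷ (3F , 4F) ∷ [])

[K₁∪K₂]+K : ∀ p → Graph (3 + p)
[K₁∪K₂]+K p = (complete 1 ∪ᴳ complete 2) +ᴳ complete p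

{-# OPTIONS --safe #-}
-- Fix a maximum clique K of G, where ω(G) ≥ 3.  As G has no induced
-- (K₁ ∪ K₂) + K_p, a vertex with two non-neighbours in K has fewer than p
-- neighbours in K; call such vertices sparse.  The other vertices miss exactly
-- one vertex of K and form a complete multipartite graph.  Two adjacent sparse
-- vertices v, w together miss two vertices a, b of K because 2p ≤ ω(G); if v
-- had a non-sparse neighbour u, one could exchange u into K, and then a, b, u,
-- v, w would be a butterfly or a hammer.  So an edge between sparse vertices
-- would spread over the whole component, which contains K: the sparse vertices
-- are independent.  A graph consisting of a complete multipartite graph and an
-- independent set, arbitrarily joined, is perfect.
module Submission where

open import Defs
open import Data.Empty using (⊥)
open import Data.Fin using (Fin; zero; suc; _<_; inject≤; punchIn; punchOut)
open import Data.Fin.Patterns using (0F; 1F; 2F; 3F; 4F)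
open import Data.Fin.Properties
  using (_≟_; all?; any?; inject≤-injective; injective⇒≤; punchIn-injective;
         punchIn-punchOut; punchInᵢ≢i; <-cmp; <⇒≢; suc-injective)
open import Data.Fin.Subset using (Subset; _∈_; ∣_∣; _∪_; ∁; inside; outside)
open import Data.Fin.Subset.Properties using (x∈p∪q⁺; x∈∁p⇒x∉p; ∣∁p∣≡n∸∣p∣)
open import Data.List using ([]; _∷_)
open import Data.List.Relation.Unary.All using ([]; _∷_)
open import Data.Nat using (ℕ; suc; _+_; _*_; _∸_; _≤_; _≥_; z≤n; s≤s; s≤s⁻¹)
import Data.Nat.Properties as ℕ
open import Data.Product using (∃; ∃₂; _×_; _,_; proj₁; proj₂)
open import Data.Sum using (inj₁; inj₂)
import Data.Sum.Relation.Binary.Pointwise as Pointwise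
open import Data.Unit using (⊤; tt)
open import Data.Vec using (here; there; tabulate) renaming ([] to []ᵥ; _∷_ to _∷ᵥ_)
open import Data.Vec.Properties using (lookup∘tabulate; lookup⇒[]=; []=⇒lookup)
open import Data.Vec.Functional using (updateAt) renaming (_∷_ to _∷ᶠ_)
open import Data.Vec.Functional.Properties using (updateAt-updates; updateAt-minimal)
open import Function using (_∘_; const)
open import Function.Bundles using (_⇔_; mk⇔; Equivalence)
open import Function.Definitions using (Injective)
open import Relation.Binary.Construct.Closure.ReflexiveTransitive using (Star; ε; _◅_)
open import Relation.Binary.Definitions using (Tri; tri<; tri≈; tri>)
open import Relation.Binary.PropositionalEquality
  using (_≡_; _≢_; refl; sym; trans; cong; subst; subst₂; ≢-sym)
open import Relation.Nullary using (¬_; Dec; yes; no; does; contradiction)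
open import Relation.Nullary.Decidable
  using (True; False; toWitness; toWitnessFalse; dec-true; decidable-stable;
         ¬?; _×-dec_; _→-dec_)
open import Relation.Unary using (Pred) renaming (Decidable to Decidable₁)
open import Level using (0ℓ)

private
  variable
    k m n p : ℕ

-- Subsets of Fin n and their enumerations

enum : (S : Subset n) → Fin ∣ S ∣ → Fin n
enum (inside  ∷ᵥ S) zero    = zero
enum (inside  ∷ᵥ S) (suc i) = suc (enum S i)
enum (outside ∷ᵥ S) i       = suc (enum S i)

enum-injective : (S : Subset n) → Injective _≡_ _≡_ (enum S)
enum-injective (inside  ∷ᵥ S) {zero}  {zero}  _  = refl
enum-injective (inside  ∷ᵥ S) {suc _} {suc _} eq =
  cong suc (enum-injective S (suc-injective eq))
enum-injective (outside ∷ᵥ S) eq = enum-injective S (suc-injective eq)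

enum-∈ : (S : Subset n) (i : Fin ∣ S ∣) → enum S i ∈ S
enum-∈ (inside  ∷ᵥ S) zero    = here
enum-∈ (inside  ∷ᵥ S) (suc i) = there (enum-∈ S i)
enum-∈ (outside ∷ᵥ S) i       = there (enum-∈ S i)

enum-surjective : (S : Subset n) {v : Fin n} → v ∈ S → ∃ λ i → enum S i ≡ v
enum-surjective (inside  ∷ᵥ S) here = zero , refl
enum-surjective (inside  ∷ᵥ S) (there v∈S) with enum-surjective S v∈S
... | i , refl = suc i , refl
enum-surjective (outside ∷ᵥ S) (there v∈S) with enum-surjective S v∈S
... | i , refl = i , refl

injection⇒≤∣∣ : (S : Subset n) {f : Fin k → Fin n} → Injective _≡_ _≡_ f →
                (∀ i → f i ∈ S) → k ≤ ∣ S ∣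
injection⇒≤∣∣ S {f} inj f∈S = injective⇒≤ {f = proj₁ ∘ index} λ {i} {j} eq →
  inj (trans (sym (proj₂ (index i))) (trans (cong (enum S) eq) (proj₂ (index j))))
  where
  index : ∀ i → ∃ λ j → enum S j ≡ f i
  index i = enum-surjective S (f∈S i)

∣p∪q∣≤∣p∣+∣q∣ : (S T : Subset n) → ∣ S ∪ T ∣ ≤ ∣ S ∣ + ∣ T ∣
∣p∪q∣≤∣p∣+∣q∣ []ᵥ []ᵥ = z≤n
∣p∪q∣≤∣p∣+∣q∣ (outside ∷ᵥ S) (outside ∷ᵥ T) = ∣p∪q∣≤∣p∣+∣q∣ S T
∣p∪q∣≤∣p∣+∣q∣ (outside ∷ᵥ S) (inside  ∷ᵥ T) =
  ℕ.≤-trans (s≤s (∣p∪q∣≤∣p∣+∣q∣ S T)) (ℕ.≤-reflexive (sym (ℕ.+-suc ∣ S ∣ ∣ T ∣)))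
∣p∪q∣≤∣p∣+∣q∣ (inside  ∷ᵥ S) (outside ∷ᵥ T) = s≤s (∣p∪q∣≤∣p∣+∣q∣ S T)
∣p∪q∣≤∣p∣+∣q∣ (inside  ∷ᵥ S) (inside  ∷ᵥ T) =
  s≤s (ℕ.≤-trans (∣p∪q∣≤∣p∣+∣q∣ S T) (ℕ.+-monoʳ-≤ ∣ S ∣ (ℕ.n≤1+n ∣ T ∣)))

module _ {P : Pred (Fin n) 0ℓ} (P? : Decidable₁ P) where

  toSubset : Subset n
  toSubset = tabulate (does ∘ P?)

  ∈-toSubset⁺ : ∀ {v} → P v → v ∈ toSubset
  ∈-toSubset⁺ {v} pv = lookup⇒[]= v toSubset
    (trans (lookup∘tabulate (does ∘ P?) v) (dec-true (P? v) pv))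

  ∈-toSubset⁻ : ∀ {v} → v ∈ toSubset → P v
  ∈-toSubset⁻ {v} v∈S
    with P? v | trans (sym (lookup∘tabulate (does ∘ P?) v)) ([]=⇒lookup v∈S)
  ... | yes pv | _  = pv
  ... | no  _  | ()

-- Supplies the indices of a clique other than two missed ones.
avoid₂ : {a b : Fin (2 + m)} → a ≢ b →
         ∃ λ (q : Fin m → Fin (2 + m)) →
           Injective _≡_ _≡_ q × (∀ i → q i ≢ a × q i ≢ b)
avoid₂ {a = a} {b} a≢b =
    punchIn a ∘ punchIn b′
  , (λ eq → punchIn-injective b′ _ _ (punchIn-injective a _ _ eq))
  , λ i → punchInᵢ≢i a _ , λ eq → punchInᵢ≢i b′ i
      (punchIn-injective a _ _ (trans eq (sym (punchIn-punchOut a≢b))))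
  where b′ = punchOut a≢b

-- Cliques

-- Indexed families rather than subsets, so that adding a vertex is a cons and exchanging one is an
-- update.
Clique : Graph n → (Fin k → Fin n) → Set
Clique G K = ∀ i j → i ≢ j → Adj G (K i) (K j)

clique-injective : (G : Graph n) {K : Fin k → Fin n} → Clique G K → Injective _≡_ _≡_ K
clique-injective G {K} cl {i} {j} eq with i ≟ j
... | yes i≡j = i≡j
... | no  i≢j = contradiction (subst (Adj G (K i)) (sym eq) (cl _ _ i≢j)) (irrefl G)

maximumClique : (G : Graph n) → ∃ λ (K : Fin (ω G) → Fin n) → Clique G K
maximumClique G with cliqueNumber G
... | _ , (S , cl , refl) , _ =
  enum S , λ i j i≢j → cl _ _ (enum-∈ S i) (enum-∈ S j) (i≢j ∘ enum-injective S)

clique≤ω : (G : Graph n) {K : Fin k → Fin n} → Clique G K → k ≤ ω G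
clique≤ω {k = k} G {K} cl =
  ℕ.≤-trans (injection⇒≤∣∣ S (clique-injective G cl) λ i → ∈-toSubset⁺ inK? (i , refl))
            (proj₂ (proj₂ (cliqueNumber G)) _ (S , S-clique , refl))
  where
  inK? : Decidable₁ λ v → ∃ λ i → K i ≡ v
  inK? v = any? λ i → K i ≟ v

  S = toSubset inK?

  S-clique : IsClique G S
  S-clique u v u∈S v∈S u≢v with ∈-toSubset⁻ inK? u∈S | ∈-toSubset⁻ inK? v∈S
  ... | i , refl | j , refl = cl _ _ (u≢v ∘ cong K)

Maximum : Graph n → ℕ → Set
Maximum {n} G k = ∀ {K : Fin (suc k) → Fin n} → ¬ Clique G K

ω-maximum : (G : Graph n) → Maximum G (ω G)
ω-maximum G cl = ℕ.<-irrefl refl (clique≤ω G cl)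

extend-clique : (G : Graph n) {K : Fin k → Fin n} {v : Fin n} →
                Clique G K → (∀ i → Adj G (K i) v) → Clique G (v ∷ᶠ K)
extend-clique G cl adj zero    zero    i≢j = contradiction refl i≢j
extend-clique G cl adj zero    (suc j) _   = symm G (adj j)
extend-clique G cl adj (suc i) zero    _   = adj i
extend-clique G cl adj (suc i) (suc j) i≢j = cl _ _ (i≢j ∘ cong suc)

-- Exchanging a vertex of a clique

infixl 9 _[_≔_]

_[_≔_] : (Fin k → Fin n) → Fin k → Fin n → Fin k → Fin n
K [ i ≔ v ] = updateAt K i (const v)

≔-here : (K : Fin k → Fin n) (i : Fin k) {v : Fin n} → (K [ i ≔ v ]) i ≡ v
≔-here K i = updateAt-updates i K

≔-there : (K : Fin k → Fin n) {i j : Fin k} {v : Fin n} → j ≢ i → (K [ i ≔ v ]) j ≡ K j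
≔-there K j≢i = updateAt-minimal _ _ K j≢i

-- Nothing is asked at `i` itself, so `v` may be `K i`. When `K` is a maximum clique, `v` then
-- misses exactly `K i` and can take its place.
Aligned : Graph n → (Fin k → Fin n) → Fin k → Fin n → Set
Aligned G K i v = ∀ j → j ≢ i → Adj G (K j) v

exchange-clique : (G : Graph n) {K : Fin k → Fin n} {i : Fin k} {v : Fin n} →
                  Clique G K → Aligned G K i v → Clique G (K [ i ≔ v ])
exchange-clique G {K} {i} {v} cl al a b a≢b with a ≟ i | b ≟ i
... | yes refl | yes refl = contradiction refl a≢b
... | yes refl | no b≢i =
  subst₂ (Adj G) (sym (≔-here K i)) (sym (≔-there K b≢i)) (symm G (al _ b≢i))
... | no a≢i | yes refl =
  subst₂ (Adj G) (sym (≔-there K a≢i)) (sym (≔-here K i)) (al _ a≢i)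
... | no a≢i | no b≢i =
  subst₂ (Adj G) (sym (≔-there K a≢i)) (sym (≔-there K b≢i)) (cl _ _ a≢b)

missed-by : (G : Graph n) → Maximum G k → {K : Fin k → Fin n} → Clique G K →
            ∀ v → ∃ λ i → ¬ Adj G (K i) v
missed-by G max {K} cl v with any? (λ i → ¬? (adj? G (K i) v))
... | yes i = i
... | no  h = contradiction
  (extend-clique G cl λ i → decidable-stable (adj? G (K i) v) λ miss → h (i , miss)) max

-- Perfection of a complete multipartite graph plus an independent set

-- In the subgraph induced on the complement of I, non-adjacency is transitive,
-- which says that this subgraph is complete multipartite.
record MultipartitePlusIndependent (G : Graph n) : Set₁ where
  field
    I            : Pred (Fin n) 0ℓ
    I?           : Decidable₁ I
    independent  : ∀ {u v} → I u → I v → ¬ Adj G u v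
    multipartite : ∀ {u v w} → ¬ I u → ¬ I v → ¬ I w →
                   ¬ Adj G u v → ¬ Adj G v w → ¬ Adj G u w

open MultipartitePlusIndependent

induced : {H : Graph m} {G : Graph n} → H ↪ G →
          MultipartitePlusIndependent G → MultipartitePlusIndependent H
induced {H = H} {G} e s = record
  { I            = I s ∘ fun e
  ; I?           = I? s ∘ fun e
  ; independent  = λ iu iv → independent s iu iv ∘ to
  ; multipartite = λ u v w uv vw → multipartite s u v w (uv ∘ from) (vw ∘ from) ∘ to
  }
  where
  to : ∀ {u v} → Adj H u v → Adj G (fun e u) (fun e v)
  to = Equivalence.to (adj-iff e _ _)

  from : ∀ {u v} → Adj G (fun e u) (fun e v) → Adj H u v
  from = Equivalence.from (adj-iff e _ _)

ω≤χ : (G : Graph n) → ω G ≤ χ G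
ω≤χ G with maximumClique G | chromaticNumber G
... | K , cl | _ , (c , proper) , _ = injective⇒≤ {f = c ∘ K} inj
  where
  inj : Injective _≡_ _≡_ (c ∘ K)
  inj {i} {j} eq with i ≟ j
  ... | yes i≡j = i≡j
  ... | no  i≢j = contradiction eq (proper _ _ (cl _ _ i≢j))

module _ {G : Graph n} (s : MultipartitePlusIndependent G)
         {K : Fin k → Fin n} (cl : Clique G K) (max : Maximum G k) where

  private
    -- The vertices `u` outside `I` that miss `K i` form the part of `K i`, and `v` may take colour
    -- `i` if it has no neighbour there. When both `v` and `K i` are outside `I`, this puts `v` into
    -- that very part.
    Suits : Fin n → Fin k → Set
    Suits v i = ∀ u → ¬ I s u → ¬ Adj G u (K i) → ¬ Adj G v u

    suits? : ∀ v i → Dec (Suits v i)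
    suits? v i = all? λ u → ¬? (I? s u) →-dec (¬? (adj? G u (K i)) →-dec ¬? (adj? G v u))

    Refutes : Fin n → Fin k → Fin n → Set
    Refutes v i u = ¬ I s u × ¬ Adj G u (K i) × Adj G v u

    refuter : ∀ {v i} → ¬ Suits v i → ∃ (Refutes v i)
    refuter {v} {i} ¬suits
      with any? (λ u → ¬? (I? s u) ×-dec (¬? (adj? G u (K i)) ×-dec adj? G v u))
    ... | yes r = r
    ... | no  h = contradiction (λ u ¬iu miss vu → h (u , ¬iu , miss , vu)) ¬suits

  -- Each part is represented by a vertex of K.  If every part contained a
  -- neighbour of v, these neighbours and v would be a clique larger than K.
  colour-outside : (∀ i → ¬ I s (K i)) → Colourable G k
  colour-outside K∉I = (λ v → proj₁ (suitable v)) , proper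
    where
    suitable : ∀ v → ∃ (Suits v)
    suitable v with any? (suits? v)
    ... | yes i = i
    ... | no  h = contradiction (extend-clique G nbrs-clique nbrs-adj) max
      where
      r : ∀ i → ∃ (Refutes v i)
      r i = refuter (λ suits → h (i , suits))

      nbrs-clique : Clique G (proj₁ ∘ r)
      nbrs-clique i j i≢j with r i | r j
      -- If `u` and `w` were not adjacent, transitivity along `K i`, `u`, `w`, `K j` would make two
      -- clique vertices non-adjacent.
      ... | u , ¬iu , ui , _ | w , ¬iw , wj , _ = decidable-stable (adj? G u w) λ ¬uw →
        multipartite s (K∉I i) ¬iw (K∉I j)
          (multipartite s (K∉I i) ¬iu ¬iw (ui ∘ symm G) ¬uw) wj (cl _ _ i≢j)

      nbrs-adj : ∀ i → Adj G (proj₁ (r i)) v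
      nbrs-adj i = symm G (proj₂ (proj₂ (proj₂ (r i))))

    separated : ∀ {u v i} → ¬ I s v → Suits u i → Suits v i → ¬ Adj G u v
    -- `sv` applied to `K i` itself places `v` in the part in which `u` has no neighbour.
    separated {v = v} {i} ¬iv su sv = su v ¬iv (sv (K i) (K∉I i) (irrefl G))

    proper : IsProper G (proj₁ ∘ suitable)
    proper u v uv eq with suitable u | suitable v
    proper u v uv refl | i , su | _ , sv with I? s u | I? s v
    ... | yes iu | yes iv = independent s iu iv uv
    ... | _      | no ¬iv = separated ¬iv su sv uv
    ... | no ¬iu | _      = separated ¬iu sv su (symm G uv)

-- If K i lies in I and no vertex outside I can be exchanged for it, then every
-- vertex outside I misses a vertex of K other than K i, and K i represents I.
colour-meeting : {G : Graph n} (s : MultipartitePlusIndependent G)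
                 {K : Fin k → Fin n} (i : Fin k) → Clique G K → I s (K i) →
                 ¬ (∃ λ u → ¬ I s u × Aligned G K i u) → Colourable G k
colour-meeting {n} {k} {G} s {K} i cl iKi rigid =
  (λ v → colour v (I? s v)) , λ u v → proper (I? s u) (I? s v)
  where
  missed : ∀ v → ¬ I s v → ∃ λ j → j ≢ i × ¬ Adj G (K j) v
  missed v ¬iv with any? (λ j → ¬? (j ≟ i) ×-dec ¬? (adj? G (K j) v))
  ... | yes j = j
  ... | no  h = contradiction
    (v , ¬iv , λ j j≢i → decidable-stable (adj? G (K j) v) λ miss → h (j , j≢i , miss)) rigid

  colour : ∀ v → Dec (I s v) → Fin k
  colour v (yes _)  = i
  colour v (no ¬iv) = proj₁ (missed v ¬iv)

  proper : ∀ {u v} (u? : Dec (I s u)) (v? : Dec (I s v)) →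
           Adj G u v → colour u u? ≢ colour v v?
  proper (yes iu) (yes iv) uv _  = independent s iu iv uv
  proper {v = v} (yes _) (no ¬iv) _ eq = proj₁ (proj₂ (missed v ¬iv)) (sym eq)
  proper {u} (no ¬iu) (yes _) _ eq = proj₁ (proj₂ (missed u ¬iu)) eq
  proper {u} {v} (no ¬iu) (no ¬iv) uv eq with missed u ¬iu | missed v ¬iv
  -- Both ends miss the same `K j`, which is outside `I` because it is adjacent to `K i`;
  -- transitivity through `K j` applies.
  proper (no ¬iu) (no ¬iv) uv refl | j , j≢i , ju | _ , _ , jv =
    multipartite s ¬iu ¬iKj ¬iv (ju ∘ symm G) jv uv
    where
    ¬iKj : ¬ I s (K j)
    ¬iKj iKj = independent s iKj iKi (cl _ _ j≢i)

-- A clique meets `I` in at most one vertex. If that vertex can be exchanged for one outside `I`,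
-- the new clique avoids `I`; otherwise it is rigid and its colour serves all of `I`.
maximum-colourable : {G : Graph n} → MultipartitePlusIndependent G →
                     {K : Fin k → Fin n} → Clique G K → Maximum G k → Colourable G k
maximum-colourable {G = G} s {K} cl max with any? (I? s ∘ K)
... | no  h = colour-outside s cl max λ i iKi → h (i , iKi)
... | yes (i , iKi)
  with any? (λ u → ¬? (I? s u) ×-dec all? λ j → ¬? (j ≟ i) →-dec adj? G (K j) u)
...   | no  h = colour-meeting s i cl iKi λ (u , ¬iu , al) → h (u , ¬iu , al)
...   | yes (u , ¬iu , al) =
  colour-outside s (exchange-clique G cl al) max exchanged
  where
  exchanged : ∀ j → ¬ I s ((K [ i ≔ u ]) j)
  exchanged j with j ≟ i
  ... | yes refl = subst (¬_ ∘ I s) (sym (≔-here K i)) ¬iu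
  ... | no  j≢i  = subst (¬_ ∘ I s) (sym (≔-there K j≢i))
                     λ iKj → independent s iKj iKi (cl _ _ j≢i)

-- The structure passes to induced subgraphs, so it is enough to colour each with as many colours as
-- its clique number.
multipartitePlusIndependent⇒perfect : {G : Graph n} →
                                      MultipartitePlusIndependent G → Perfect G
multipartitePlusIndependent⇒perfect s H e = ℕ.≤-antisym
  (proj₂ (proj₂ (chromaticNumber H)) _
    (maximum-colourable (induced e s) (proj₂ (maximumClique H)) (ω-maximum H)))
  (ω≤χ H)

-- Embeddings of the forbidden graphs

module _ {H : Graph m} {G : Graph n} {f : Fin m → Fin n} where

  loop : ∀ u → Adj H u u ⇔ Adj G (f u) (f u)
  loop u = mk⇔ (λ e → contradiction e (irrefl H)) (λ e → contradiction e (irrefl G))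

  flip : ∀ {u v} → Adj H u v ⇔ Adj G (f u) (f v) → Adj H v u ⇔ Adj G (f v) (f u)
  flip iff = mk⇔ (symm G ∘ Equivalence.to iff ∘ symm H)
                 (symm H ∘ Equivalence.from iff ∘ symm G)

  -- Symmetry and irreflexivity of both graphs settle the remaining pairs.
  embedding : (∀ u v → u < v → f u ≢ f v × (Adj H u v ⇔ Adj G (f u) (f v))) → H ↪ G
  embedding upper = record
    { fun       = f
    ; injective = λ {u} {v} → injective′ u v (<-cmp u v)
    ; adj-iff   = λ u v → iff u v (<-cmp u v)
    }
    where
    injective′ : ∀ u v → Tri (u < v) (u ≡ v) (v < u) → f u ≡ f v → u ≡ v
    injective′ u v (tri< u<v _ _) eq = contradiction eq (proj₁ (upper u v u<v))
    injective′ u v (tri≈ _ u≡v _) _  = u≡v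
    injective′ u v (tri> _ _ v<u) eq = contradiction (sym eq) (proj₁ (upper v u v<u))

    iff : ∀ u v → Tri (u < v) (u ≡ v) (v < u) → Adj H u v ⇔ Adj G (f u) (f v)
    iff u v (tri< u<v _ _)  = proj₂ (upper u v u<v)
    iff u _ (tri≈ _ refl _) = loop u
    iff u v (tri> _ _ v<u)  = flip (proj₂ (upper v u v<u))

adjacent⇒≢ : (G : Graph n) {u v : Fin n} → Adj G u v → u ≢ v
adjacent⇒≢ G uv refl = irrefl G uv

-- Yields distinctness where the two vertices are not known to be adjacent.
separated⇒≢ : (G : Graph n) {u v w : Fin n} → Adj G u w → ¬ Adj G v w → u ≢ v
separated⇒≢ G uw v≁w refl = v≁w uw

both : {A B : Set} → A → B → A ⇔ B
both a b = mk⇔ (const b) (const a)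

neither : {A B : Set} → ¬ A → ¬ B → A ⇔ B
neither ¬a ¬b = mk⇔ (λ a → contradiction a ¬a) (λ b → contradiction b ¬b)

edge : (H : Graph m) (u v : Fin m) {_ : True (adj? H u v)} → Adj H u v
edge H u v {t} = toWitness t

non-edge : (H : Graph m) (u v : Fin m) {_ : False (adj? H u v)} → ¬ Adj H u v
non-edge H u v {t} = toWitnessFalse t

-- The hammer and the butterfly differ only in the edge 24.
module _ {G : Graph n} {a b c d e : Fin n}
         (ab : Adj G a b) (bc : Adj G b c) (ac : Adj G a c)
         (cd : Adj G c d) (de : Adj G d e)
         (a≁d : ¬ Adj G a d) (b≁d : ¬ Adj G b d)
         (a≁e : ¬ Adj G a e) (b≁e : ¬ Adj G b e) where

  private
    f : Fin 5 → Fin n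
    f 0F = a
    f 1F = b
    f 2F = c
    f 3F = d
    f 4F = e

    module _ (H : Graph 5)
             (h01 : Adj H 0F 1F) (h02 : Adj H 0F 2F) (h12 : Adj H 1F 2F)
             (h23 : Adj H 2F 3F) (h34 : Adj H 3F 4F)
             (h03 : ¬ Adj H 0F 3F) (h04 : ¬ Adj H 0F 4F)
             (h13 : ¬ Adj H 1F 3F) (h14 : ¬ Adj H 1F 4F)
             (iff24 : Adj H 2F 4F ⇔ Adj G c e) where

      upper : ∀ u v → u < v → f u ≢ f v × (Adj H u v ⇔ Adj G (f u) (f v))
      upper 0F 1F _ = adjacent⇒≢ G ab , both h01 ab
      upper 0F 2F _ = adjacent⇒≢ G ac , both h02 ac
      upper 0F 3F _ = separated⇒≢ G ab (b≁d ∘ symm G) , neither h03 a≁d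
      upper 0F 4F _ = separated⇒≢ G ab (b≁e ∘ symm G) , neither h04 a≁e
      upper 1F 2F _ = adjacent⇒≢ G bc , both h12 bc
      upper 1F 3F _ = separated⇒≢ G (symm G ab) (a≁d ∘ symm G) , neither h13 b≁d
      upper 1F 4F _ = separated⇒≢ G (symm G ab) (a≁e ∘ symm G) , neither h14 b≁e
      upper 2F 3F _ = adjacent⇒≢ G cd , both h23 cd
      upper 2F 4F _ = separated⇒≢ G (symm G ac) (a≁e ∘ symm G) , iff24
      upper 3F 4F _ = adjacent⇒≢ G de , both h34 de
      upper 1F 1F (s≤s ())
      upper 2F 1F (s≤s ())
      upper 3F 1F (s≤s ())
      upper 4F 1F (s≤s ())
      upper 2F 2F (s≤s (s≤s ()))
      upper 3F 2F (s≤s (s≤s ()))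
      upper 4F 2F (s≤s (s≤s ()))
      upper 3F 3F (s≤s (s≤s (s≤s ())))
      upper 4F 3F (s≤s (s≤s (s≤s ())))
      upper 4F 4F (s≤s (s≤s (s≤s (s≤s ()))))

  butterfly-or-hammer : ¬ (butterfly ↪ G) → ¬ (hammer ↪ G) → ⊥
  butterfly-or-hammer no-butterfly no-hammer with adj? G c e
  ... | yes ce = no-butterfly (embedding (upper butterfly
    (edge butterfly 0F 1F) (edge butterfly 0F 2F) (edge butterfly 1F 2F)
    (edge butterfly 2F 3F) (edge butterfly 3F 4F)
    (non-edge butterfly 0F 3F) (non-edge butterfly 0F 4F)
    (non-edge butterfly 1F 3F) (non-edge butterfly 1F 4F)
    (both (edge butterfly 2F 4F) ce)))
  ... | no c≁e = no-hammer (embedding (upper hammer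
    (edge hammer 0F 1F) (edge hammer 0F 2F) (edge hammer 1F 2F)
    (edge hammer 2F 3F) (edge hammer 3F 4F)
    (non-edge hammer 0F 3F) (non-edge hammer 0F 4F)
    (non-edge hammer 1F 3F) (non-edge hammer 1F 4F)
    (neither (non-edge hammer 2F 4F) c≁e)))

[K₁∪K₂]+K-embedding :
  {G : Graph n} {x y z : Fin n} {Q : Fin p → Fin n} →
  ¬ Adj G x y → ¬ Adj G x z → Adj G y z → Clique G Q →
  (∀ i → Adj G x (Q i)) → (∀ i → Adj G y (Q i)) → (∀ i → Adj G z (Q i)) →
  [K₁∪K₂]+K p ↪ G
[K₁∪K₂]+K-embedding {n} {p} {G} {x} {y} {z} {Q} x≁y x≁z yz clQ xQ yQ zQ = embedding upper
  where
  f : Fin (3 + p) → Fin n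
  f 0F = x
  f 1F = y
  f 2F = z
  f (suc (suc (suc i))) = Q i

  upper : ∀ u v → u < v → f u ≢ f v × (Adj ([K₁∪K₂]+K p) u v ⇔ Adj G (f u) (f v))
  upper 0F 1F _ = ≢-sym (separated⇒≢ G yz x≁z) , neither (λ ()) x≁y
  upper 0F 2F _ = ≢-sym (separated⇒≢ G (symm G yz) x≁y) , neither (λ ()) x≁z
  upper 0F (suc (suc (suc i))) _ = adjacent⇒≢ G (xQ i) , both tt (xQ i)
  upper 1F 2F _ = adjacent⇒≢ G yz , both (Pointwise.inj₂ λ ()) yz
  upper 1F (suc (suc (suc i))) _ = adjacent⇒≢ G (yQ i) , both tt (yQ i)
  upper 2F (suc (suc (suc i))) _ = adjacent⇒≢ G (zQ i) , both tt (zQ i)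
  upper (suc (suc (suc i))) (suc (suc (suc j))) (s≤s (s≤s (s≤s i<j))) =
    adjacent⇒≢ G (clQ i j i≢j) , both i≢j (clQ i j i≢j)
    where i≢j = <⇒≢ i<j
  upper 1F 1F (s≤s ())
  upper 2F 1F (s≤s ())
  upper 2F 2F (s≤s (s≤s ()))
  upper (suc (suc (suc _))) 1F (s≤s ())
  upper (suc (suc (suc _))) 2F (s≤s (s≤s ()))

-- Sparse vertices

-- Two missed vertices form the `K₂` of a forbidden graph; the bound on the number of neighbours is
-- derived from this.
Sparse : Graph n → (Fin k → Fin n) → Pred (Fin n) 0ℓ
Sparse G K v = ∃₂ λ a b → a ≢ b × ¬ Adj G (K a) v × ¬ Adj G (K b) v

sparse? : (G : Graph n) (K : Fin k → Fin n) → Decidable₁ (Sparse G K)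
sparse? G K v = any? λ a → any? λ b →
  ¬? (a ≟ b) ×-dec (¬? (adj? G (K a) v) ×-dec ¬? (adj? G (K b) v))

¬sparse⇒aligned : (G : Graph n) → Maximum G k → {K : Fin k → Fin n} → Clique G K →
                  ∀ {v} → ¬ Sparse G K v → ∃ λ i → Aligned G K i v
¬sparse⇒aligned G max {K} cl {v} ¬sp with missed-by G max cl v
... | i , miss = i , λ j j≢i → decidable-stable (adj? G (K j) v) λ miss′ →
  ¬sp (i , j , ≢-sym j≢i , miss , miss′)

-- Were `u` and `v` adjacent, putting `u` in place of `K i` and then adding `v` would give too large
-- a clique.
same-part : (G : Graph n) → Maximum G k → {K : Fin k → Fin n} → Clique G K →
            ∀ {i u v} → Aligned G K i u → Aligned G K i v → ¬ Adj G u v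
same-part G max {K} cl {i} {u} {v} alu alv uv =
  max (extend-clique G (exchange-clique G cl alu) adj)
  where
  adj : ∀ j → Adj G ((K [ i ≔ u ]) j) v
  adj j with j ≟ i
  ... | yes refl = subst (λ x → Adj G x v) (sym (≔-here K i)) uv
  ... | no  j≢i  = subst (λ x → Adj G x v) (sym (≔-there K j≢i)) (alv _ j≢i)

≔-missed : (G : Graph n) {K : Fin k → Fin n} {i j : Fin k} {u v : Fin n} → j ≢ i →
           ¬ Adj G (K j) v → ¬ Adj G ((K [ i ≔ u ]) j) v
≔-missed G {K} {v = v} j≢i = subst (λ x → ¬ Adj G x v) (sym (≔-there K j≢i))

-- Consequences of excluding (K₁ ∪ K₂) + K_p

module _ {G : Graph n} (no-K₁∪K₂+Kₚ : ¬ ([K₁∪K₂]+K p ↪ G)) where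

  -- Otherwise `v` as `K₁`, two missed vertices as `K₂` and `p` neighbours as `K_p` induce the
  -- forbidden graph.
  sparse-few-neighbours : {K : Fin k → Fin n} → Clique G K → ∀ {v} → Sparse G K v →
                          {q : Fin p → Fin k} → Injective _≡_ _≡_ q →
                          ¬ (∀ i → Adj G (K (q i)) v)
  sparse-few-neighbours {K = K} cl {v} (a , b , a≢b , av , bv) {q} q-inj adj =
    no-K₁∪K₂+Kₚ ([K₁∪K₂]+K-embedding (av ∘ symm G) (bv ∘ symm G) (cl _ _ a≢b)
      (λ i j i≢j → cl _ _ (i≢j ∘ q-inj)) (λ i → symm G (adj i))
      (λ i → cl _ _ (avoids av i)) (λ i → cl _ _ (avoids bv i)))
    where
    avoids : ∀ {c} → ¬ Adj G (K c) v → ∀ i → c ≢ q i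
    avoids cv i c≡qi = cv (subst (λ j → Adj G (K j) v) (sym c≡qi) (adj i))

  -- Each of `v` and `w` has at most `p` - 1 neighbours in `K`, so together they leave at least `k`
  -- - (2`p` - 2) ≥ 2 vertices untouched.
  sparse-common-misses : 2 * p ≤ k → {K : Fin k → Fin n} → Clique G K →
                         ∀ {v w} → Sparse G K v → Sparse G K w →
                         ∃₂ λ a b → a ≢ b × (¬ Adj G (K a) v × ¬ Adj G (K a) w)
                                          × (¬ Adj G (K b) v × ¬ Adj G (K b) w)
  sparse-common-misses {k} 2p≤k {K} cl {v} {w} spv spw =
    e 0F , e 1F , (λ eq → contradiction (e-injective eq) λ ()) , misses 0F , misses 1F
    where
    nbrs : Fin n → Subset k
    nbrs x = toSubset λ i → adj? G (K i) x

    few : ∀ {x} → Sparse G K x → suc ∣ nbrs x ∣ ≤ p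
    few {x} sp = ℕ.≰⇒> λ p≤ → sparse-few-neighbours cl sp
      (λ eq → inject≤-injective p≤ p≤ _ _ (enum-injective (nbrs x) eq))
      (λ i → ∈-toSubset⁻ (λ j → adj? G (K j) x) (enum-∈ (nbrs x) (inject≤ i p≤)))

    S = ∁ (nbrs v ∪ nbrs w)

    2≤∣S∣ : 2 ≤ ∣ S ∣
    2≤∣S∣ = begin
      2                        ≤⟨ ℕ.m+n≤o⇒m≤o∸n 2 bound ⟩
      k ∸ ∣ nbrs v ∪ nbrs w ∣  ≡⟨ ∣∁p∣≡n∸∣p∣ (nbrs v ∪ nbrs w) ⟨
      ∣ S ∣                    ∎
      where
      open ℕ.≤-Reasoning
      bound : 2 + ∣ nbrs v ∪ nbrs w ∣ ≤ k
      bound = begin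
        2 + ∣ nbrs v ∪ nbrs w ∣            ≤⟨ ℕ.+-monoʳ-≤ 2 (∣p∪q∣≤∣p∣+∣q∣ (nbrs v) (nbrs w)) ⟩
        2 + (∣ nbrs v ∣ + ∣ nbrs w ∣)      ≡⟨ cong suc (ℕ.+-suc ∣ nbrs v ∣ ∣ nbrs w ∣) ⟨
        suc ∣ nbrs v ∣ + suc ∣ nbrs w ∣    ≤⟨ ℕ.+-mono-≤ (few spv) (few spw) ⟩
        p + p                              ≡⟨ cong (p +_) (ℕ.+-identityʳ p) ⟨
        2 * p                              ≤⟨ 2p≤k ⟩
        k                                  ∎

    e : Fin 2 → Fin k
    e i = enum S (inject≤ i 2≤∣S∣)

    e-injective : Injective _≡_ _≡_ e
    e-injective eq = inject≤-injective 2≤∣S∣ 2≤∣S∣ _ _ (enum-injective S eq)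

    misses : ∀ i → ¬ Adj G (K (e i)) v × ¬ Adj G (K (e i)) w
    misses i = (λ adj → outside-both (inj₁ (∈-toSubset⁺ (λ j → adj? G (K j) v) adj)))
             , (λ adj → outside-both (inj₂ (∈-toSubset⁺ (λ j → adj? G (K j) w) adj)))
      where
      outside-both = x∈∁p⇒x∉p (enum-∈ S (inject≤ i 2≤∣S∣)) ∘ x∈p∪q⁺

  module _ (p≤m : p ≤ m) (max : Maximum G (2 + m)) where

    -- Otherwise `v` is adjacent to all `m` ≥ `p` other vertices of `K`, too many for a sparse
    -- vertex.
    sparse-third-miss : {K : Fin (2 + m) → Fin n} → Clique G K → ∀ {v a b} → a ≢ b →
                        ¬ Adj G (K a) v → ¬ Adj G (K b) v →
                        ∃ λ c → c ≢ a × c ≢ b × ¬ Adj G (K c) v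
    sparse-third-miss {K} cl {v} {a} {b} a≢b av bv
      with any? (λ c → ¬? (c ≟ a) ×-dec (¬? (c ≟ b) ×-dec ¬? (adj? G (K c) v))) | avoid₂ a≢b
    ... | yes c | _ = c
    ... | no  h | q , q-inj , q≢ = contradiction
      (λ i → decidable-stable (adj? G (K (q (inject≤ i p≤m))) v) λ miss →
        h (_ , proj₁ (q≢ (inject≤ i p≤m)) , proj₂ (q≢ (inject≤ i p≤m)) , miss))
      (sparse-few-neighbours cl (a , b , a≢b , av , bv)
        (λ eq → inject≤-injective p≤m p≤m _ _ (q-inj eq)))

    -- At least three vertices of `K` are missed, and the exchange removes at most one of them.
    sparse-exchange : {K : Fin (2 + m) → Fin n} → Clique G K → ∀ {i u v} →
                      Sparse G K v → Sparse G (K [ i ≔ u ]) v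
    sparse-exchange cl {i} (a , b , a≢b , av , bv)
      with sparse-third-miss cl a≢b av bv | a ≟ i | b ≟ i
    ... | _                  | no a≢i   | no b≢i   =
      a , b , a≢b , ≔-missed G a≢i av , ≔-missed G b≢i bv
    ... | c , c≢a , c≢b , cv | yes refl | _        =
      c , b , c≢b , ≔-missed G c≢a cv , ≔-missed G (≢-sym a≢b) bv
    ... | c , c≢a , c≢b , cv | _        | yes refl =
      c , a , c≢a , ≔-missed G c≢b cv , ≔-missed G a≢b av

    -- With `u` in place of `K i`, a non-neighbour `v` of `u` would miss both `u` and `K j`, hence a
    -- third vertex, against its alignment with `j`.
    distinct-parts : {K : Fin (2 + m) → Fin n} → Clique G K → ∀ {i j u v} → i ≢ j →
                     Aligned G K i u → Aligned G K j v → Adj G u v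
    distinct-parts {K} cl {i} {j} {u} {v} i≢j alu alv =
      decidable-stable (adj? G u v) λ u≁v → third
        (sparse-third-miss (exchange-clique G cl alu) i≢j
          (subst (λ x → ¬ Adj G x v) (sym (≔-here K i)) u≁v)
          (subst (λ x → ¬ Adj G x v) (sym (≔-there K (≢-sym i≢j))) j-missed))
      where
      third : ¬ ∃ λ c → c ≢ i × c ≢ j × ¬ Adj G ((K [ i ≔ u ]) c) v
      third (c , c≢i , c≢j , cv) =
        cv (subst (λ x → Adj G x v) (sym (≔-there K c≢i)) (alv _ c≢j))

      j-missed : ¬ Adj G (K j) v
      j-missed jv with missed-by G max cl v
      ... | c , cv with c ≟ j
      ...   | yes refl = cv jv
      ...   | no  c≢j  = cv (alv _ c≢j)

    -- Non-sparse vertices are non-adjacent exactly when aligned with the same index, and equality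
    -- of indices is transitive.
    nonsparse-multipartite : {K : Fin (2 + m) → Fin n} → Clique G K → ∀ {u v w} →
      ¬ Sparse G K u → ¬ Sparse G K v → ¬ Sparse G K w →
      ¬ Adj G u v → ¬ Adj G v w → ¬ Adj G u w
    nonsparse-multipartite cl ¬spu ¬spv ¬spw u≁v v≁w uw
      with ¬sparse⇒aligned G max cl ¬spu | ¬sparse⇒aligned G max cl ¬spv
         | ¬sparse⇒aligned G max cl ¬spw
    ... | i , alu | j , alv | l , alw with i ≟ j | j ≟ l
    ... | no i≢j   | _        = u≁v (distinct-parts cl i≢j alu alv)
    ... | _        | no j≢l   = v≁w (distinct-parts cl j≢l alv alw)
    ... | yes refl | yes refl = same-part G max cl alu alw uw

    -- Edges between sparse vertices

    module _ (2p≤2+m : 2 * p ≤ 2 + m)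
             (no-butterfly : ¬ (butterfly ↪ G)) (no-hammer : ¬ (hammer ↪ G)) where

      sparse-edge-isolated : {K : Fin (2 + m) → Fin n} → Clique G K → ∀ {u v w} →
        Sparse G K v → Sparse G K w → Adj G v w → ¬ Sparse G K u → ¬ Adj G v u
      sparse-edge-isolated {K} cl {u} {v} {w} spv spw vw ¬spu vu =
        let i , al = ¬sparse⇒aligned G max cl ¬spu
            cl′ = exchange-clique G cl al
            a , b , a≢b , (av , aw) , (bv , bw) = sparse-common-misses 2p≤2+m cl′
              (sparse-exchange cl {i} {u} spv) (sparse-exchange cl {i} {u} spw)
        -- The triangle is `a`, `b`, `u` and the path `u`, `v`, `w`; whether `u` and `w` are
        -- adjacent decides between the two graphs.
        in butterfly-or-hammer (cl′ _ _ a≢b) (to-u al bv) (to-u al av) (symm G vu) vw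
             av bv aw bw no-butterfly no-hammer
        where
        to-u : ∀ {i c} → Aligned G K i u →
               ¬ Adj G ((K [ i ≔ u ]) c) v → Adj G ((K [ i ≔ u ]) c) u
        -- The new vertex at `i` is `u`, a neighbour of `v`, so a missed index differs from `i`.
        to-u {i} {c} al cv = subst (Adj G _) (≔-here K i) (exchange-clique G cl al c i λ { refl →
          cv (subst (λ x → Adj G x v) (sym (≔-here K i)) (symm G vu)) })

      sparse-independent : Connected G → {K : Fin (2 + m) → Fin n} → Clique G K → ∀ {v w} →
                           Sparse G K v → Sparse G K w → ¬ Adj G v w
      sparse-independent conn {K} cl {v} {w} spv spw vw =
        K₀-not-sparse (spread (conn v (K 0F)) spv (w , spw , vw))
        where
        -- The invariant along the walk is a sparse vertex with a sparse neighbour; after the first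
        -- step that neighbour is the preceding vertex.
        spread : ∀ {x y} → Star (Adj G) x y → Sparse G K x →
                 (∃ λ z → Sparse G K z × Adj G x z) → Sparse G K y
        spread ε spx _ = spx
        spread {x} (_◅_ {j = y} xy path) spx (z , spz , xz) =
          spread path (decidable-stable (sparse? G K y) λ ¬spy →
                         sparse-edge-isolated cl spx spz xz ¬spy xy)
                 (x , spx , symm G xy)

        K₀-not-sparse : ¬ Sparse G K (K 0F)
        -- A vertex of the clique misses only itself.
        K₀-not-sparse (a , b , a≢b , a0 , b0) with a ≟ 0F | b ≟ 0F
        ... | no a≢0   | _        = a0 (cl _ _ a≢0)
        ... | _        | no b≢0   = b0 (cl _ _ b≢0)
        ... | yes refl | yes refl = a≢b refl

-- Case distinction on the clique number

edge-clique : (G : Graph n) {u v : Fin n} → Adj G u v → Clique G (u ∷ᶠ λ (_ : Fin 1) → v)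
edge-clique G uv = extend-clique G (λ { 0F 0F 0≢0 → contradiction refl 0≢0 })
                                   (λ _ → symm G uv)

edgeless : (G : Graph n) → (∀ u v → ¬ Adj G u v) → MultipartitePlusIndependent G
edgeless G no-edge = record
  { I            = λ _ → ⊤
  ; I?           = λ _ → yes tt
  ; independent  = λ _ _ → no-edge _ _
  ; multipartite = λ ¬⊤ → contradiction tt ¬⊤
  }

-- With `k` = 3 + `m`: if `p` ≤ 1 then `p` + 2 ≤ 3 ≤ `k`, and otherwise `p` + 2 ≤ 2`p` ≤ `k`.
2p≤k⇒p+2≤k : ∀ p {m} → 2 * p ≤ 3 + m → p ≤ suc m
2p≤k⇒p+2≤k 0             _   = z≤n
2p≤k⇒p+2≤k 1             _   = s≤s z≤n
2p≤k⇒p+2≤k (suc (suc p)) {m} 2p≤k = begin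
  2 + p            ≡⟨ ℕ.+-identityʳ (2 + p) ⟨
  2 + p + 0        ≤⟨ ℕ.m≤n+m _ p ⟩
  p + (2 + p + 0)  ≤⟨ s≤s⁻¹ (s≤s⁻¹ 2p≤k) ⟩
  suc m            ∎
  where open ℕ.≤-Reasoning

theorem3p16 : ∀ (p : ℕ) {n : ℕ} (G : Graph n) →
    Connected G →
    Free ((5 , butterfly) ∷ (5 , hammer) ∷ (_ , [K₁∪K₂]+K p) ∷ []) G →
    ω G ≥ 2 * p →
    ω G ≢ 2 →
    Perfect G
theorem3p16 p G conn (no-butterfly ∷ no-hammer ∷ no-K₁∪K₂+Kₚ ∷ []) ω≥2p ω≢2 =
  multipartitePlusIndependent⇒perfect
    (structure (ω G) ω≥2p ω≢2 (proj₂ (maximumClique G)) (clique≤ω G))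
  where
  -- The clique number is generalised to a variable `k` so that it can be matched on.
  structure : ∀ k → 2 * p ≤ k → k ≢ 2 → {K : Fin k → Fin _} → Clique G K →
              (∀ {j} {K′ : Fin j → Fin _} → Clique G K′ → j ≤ k) →
              MultipartitePlusIndependent G
  structure 0 _ _ _ bound = edgeless G λ u v uv →
    contradiction (bound (edge-clique G uv)) λ ()
  structure 1 _ _ _ bound = edgeless G λ u v uv →
    contradiction (bound (edge-clique G uv)) λ { (s≤s ()) }
  structure 2 _ 2≢2 _ _ = contradiction refl 2≢2
  -- The lemmas on sparse vertices, stated for size 2 + `m`, are used with `suc m` for `m`.
  structure (suc (suc (suc m))) 2p≤k _ {K} cl bound = record
    { I            = Sparse G K
    ; I?           = sparse? G K
    ; independent  = sparse-independent no-K₁∪K₂+Kₚ p+2≤k max 2p≤k no-butterfly no-hammer conn cl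
    ; multipartite = nonsparse-multipartite no-K₁∪K₂+Kₚ p+2≤k max cl
    }
    where
    p+2≤k = 2p≤k⇒p+2≤k p 2p≤k

    max : Maximum G (3 + m)
    max cl′ = ℕ.<-irrefl refl (bound cl′)
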